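{- Let $\vec U$ be a finite universe of separations and let $\vec U'=[x,x^*]\subseteq\vec U$ be a (non-empty) symmetric interval in $\vec U$. Suppose that $f\colon\vec U'\to\mathbb R_{\ge0}$ is a submodular order function on $\vec U'$ with maximum value $k$. Then there exists a submodular order function $g\colon\vec U\to\mathbb R_{\ge0}$ such that $g(z)=f(z)$ for all $z\in\vec U'$ and $g(z)>k$ for all $z\in\vec U\setminus\vec U'$.
   Context: A universe of separations is a lattice $\vec U$ equipped with an order-reversing involution ${}^*$. For $x\in\vec U$, $[x,x^*]=\{s\in\vec U\mid x\le s\le x^*\}$; it is closed under ${}^*$, joins and meets, hence itself a universe with the restricted structure. A submodular order function on a universe $\vec W$ is a function $f\colon\vec W\to\mathbb R_{\ge0}$ with $f(r\vee s)+f(r\wedge s)\le f(r)+f(s)$ for all $r,s\in\vec W$ and $f(s)=f(s^*)$ for all $s\in\vec W$. -}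

module Defs where

open import Algebra.Definitions using (Involutive)
open import Data.Fin.Properties using (≡-setoid)
open import Data.Nat.Base as ℕ using (ℕ)
import Data.Nat.Properties as ℕ
open import Data.Product.Base using (Σ; Σ-syntax; ∃; _×_; _,_; proj₁; proj₂)
open import Data.Rational.Base as ℚ using (ℚ; 0ℚ; ½; ∣_∣; _+_; _-_; _*_; -_)
import Data.Rational.Properties as ℚ
open import Data.Rational.Solver using (module +-*-Solver)
open import Function.Bundles using (Bijection; Func)
open import Level using (Level; 0ℓ; suc; _⊔_)
open import Relation.Binary.Bundles using (Setoid)
open import Relation.Binary.Definitions using (Antitonic₁)
open import Relation.Binary.Lattice.Bundles using (Lattice)
open import Relation.Binary.PropositionalEquality using (_≡_; refl; sym; trans; cong; subst)

private
  variable
    c ℓ₁ ℓ₂ : Level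

  half-pos : ∀ {ε} → 0ℚ ℚ.< ε → 0ℚ ℚ.< ε * ½
  half-pos {ε} 0<ε = subst (ℚ._< ε * ½) (ℚ.*-zeroˡ ½) (ℚ.*-monoˡ-<-pos ½ 0<ε)

  half+half : ∀ ε → ε * ½ + ε * ½ ≡ ε
  half+half ε = trans (sym (ℚ.*-distribˡ-+ ε ½ ½)) (ℚ.*-identityʳ ε)

  ∣p-p∣≡0 : ∀ p → ∣ p - p ∣ ≡ 0ℚ
  ∣p-p∣≡0 p = cong ∣_∣ (ℚ.+-inverseʳ p)

  ∣p-q∣≡∣q-p∣ : ∀ p q → ∣ p - q ∣ ≡ ∣ q - p ∣
  ∣p-q∣≡∣q-p∣ p q = trans (cong ∣_∣ (lemma p q)) (ℚ.∣-p∣≡∣p∣ (q - p))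
    where
    open +-*-Solver
    lemma : ∀ p q → p - q ≡ - (q - p)
    lemma = solve 2 (λ p q → (p :- q) := :- (q :- p)) refl

  small+small : ∀ {a b ε} → ∣ a ∣ ℚ.< ε * ½ → ∣ b ∣ ℚ.< ε * ½ → ∣ a + b ∣ ℚ.< ε
  small+small {a} {b} {ε} a<ε/2 b<ε/2 = subst (∣ a + b ∣ ℚ.<_) (half+half ε)
    (ℚ.≤-<-trans (ℚ.∣p+q∣≤∣p∣+∣q∣ a b) (ℚ.+-mono-< a<ε/2 b<ε/2))

-- The library has no real numbers: ℝ is the setoid of Cauchy sequences of
-- rationals modulo null sequences.

record ℝ : Set where
  constructor mkℝ
  field
    seq    : ℕ → ℚ
    cauchy : ∀ ε → 0ℚ ℚ.< ε →
             ∃ λ N → ∀ m n → N ℕ.≤ m → N ℕ.≤ n → ∣ seq m - seq n ∣ ℚ.< ε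

open ℝ

Eventually : (ℕ → Set) → Set
Eventually P = ∃ λ N → ∀ n → N ℕ.≤ n → P n

infix  4 _≃ℝ_ _≤ℝ_ _<ℝ_
infixl 6 _+ℝ_

_≃ℝ_ : ℝ → ℝ → Set
a ≃ℝ b = ∀ ε → 0ℚ ℚ.< ε → Eventually λ n → ∣ seq a n - seq b n ∣ ℚ.< ε

-- The slack ε is needed: pointwise comparison of representatives would not
-- respect _≃ℝ_.
_≤ℝ_ : ℝ → ℝ → Set
a ≤ℝ b = ∀ ε → 0ℚ ℚ.< ε → Eventually λ n → seq a n ℚ.≤ seq b n + ε

_<ℝ_ : ℝ → ℝ → Set
a <ℝ b = ∃ λ ε → 0ℚ ℚ.< ε × Eventually λ n → seq a n + ε ℚ.≤ seq b n

0ℝ : ℝ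
0ℝ = mkℝ (λ _ → 0ℚ) λ ε 0<ε → 0 , λ _ _ _ _ → 0<ε

_+ℝ_ : ℝ → ℝ → ℝ
seq (a +ℝ b) n = seq a n + seq b n
cauchy (a +ℝ b) ε 0<ε =
  let Nᵃ , pᵃ = cauchy a (ε * ½) (half-pos 0<ε)
      Nᵇ , pᵇ = cauchy b (ε * ½) (half-pos 0<ε)
  in Nᵃ ℕ.⊔ Nᵇ , λ m n N≤m N≤n →
     subst (λ d → ∣ d ∣ ℚ.< ε) (sym (rearrange (seq a m) (seq b m) (seq a n) (seq b n)))
       (small+small
         (pᵃ m n (ℕ.m⊔n≤o⇒m≤o Nᵃ Nᵇ N≤m) (ℕ.m⊔n≤o⇒m≤o Nᵃ Nᵇ N≤n))
         (pᵇ m n (ℕ.m⊔n≤o⇒n≤o Nᵃ Nᵇ N≤m) (ℕ.m⊔n≤o⇒n≤o Nᵃ Nᵇ N≤n)))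
  where
  open +-*-Solver
  rearrange : ∀ p q r s → (p + q) - (r + s) ≡ (p - r) + (q - s)
  rearrange = solve 4 (λ p q r s → (p :+ q) :- (r :+ s) := (p :- r) :+ (q :- s)) refl

ℝ-setoid : Setoid 0ℓ 0ℓ
ℝ-setoid = record
  { Carrier       = ℝ
  ; _≈_           = _≃ℝ_
  ; isEquivalence = record
    { refl  = λ {a} ε 0<ε → 0 , λ n _ → subst (ℚ._< ε) (sym (∣p-p∣≡0 (seq a n))) 0<ε
    ; sym   = λ {a} {b} a≃b ε 0<ε →
        let N , p = a≃b ε 0<ε
        in N , λ n N≤n → subst (ℚ._< ε) (∣p-q∣≡∣q-p∣ (seq a n) (seq b n)) (p n N≤n)
    ; trans = λ {a} {b} {d} a≃b b≃d ε 0<ε →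
        let N , p = a≃b (ε * ½) (half-pos 0<ε)
            M , q = b≃d (ε * ½) (half-pos 0<ε)
        in N ℕ.⊔ M , λ n N⊔M≤n →
           subst (λ t → ∣ t ∣ ℚ.< ε) (telescope (seq a n) (seq b n) (seq d n))
             (small+small (p n (ℕ.m⊔n≤o⇒m≤o N M N⊔M≤n)) (q n (ℕ.m⊔n≤o⇒n≤o N M N⊔M≤n)))
    }
  }
  where
  open +-*-Solver
  telescope : ∀ p q r → (p - q) + (q - r) ≡ p - r
  telescope = solve 3 (λ p q r → (p :- q) :+ (q :- r) := p :- r) refl

record UniverseOfSeparations c ℓ₁ ℓ₂ : Set (suc (c ⊔ ℓ₁ ⊔ ℓ₂)) where
  infix 8 _*
  field
    lattice : Lattice c ℓ₁ ℓ₂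

  open Lattice lattice public

  field
    _*           : Carrier → Carrier
    *-reverses-≤ : Antitonic₁ _≤_ _≤_ _*
    *-involutive : Involutive _≈_ _*

Finite : UniverseOfSeparations c ℓ₁ ℓ₂ → Set _
Finite U = Σ[ n ∈ ℕ ] Bijection (≡-setoid n) (UniverseOfSeparations.setoid U)

module _ (U : UniverseOfSeparations c ℓ₁ ℓ₂) where
  open UniverseOfSeparations U

  InInterval : Carrier → Carrier → Set ℓ₂
  InInterval x s = x ≤ s × s ≤ x *

  -- No assumption x ≤ x * is made, so the interval may be empty.
  interval : Carrier → UniverseOfSeparations (c ⊔ ℓ₂) ℓ₁ ℓ₂
  interval x = record
    { lattice = record
      { Carrier   = Σ[ s ∈ Carrier ] InInterval x s
      ; _≈_       = λ r s → proj₁ r ≈ proj₁ s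
      ; _≤_       = λ r s → proj₁ r ≤ proj₁ s
      ; _∨_       = λ (r , x≤r , r≤x*) (s , x≤s , s≤x*) →
          r ∨ s , ≤-trans x≤r (x≤x∨y r s) , ∨-least r≤x* s≤x*
      ; _∧_       = λ (r , x≤r , r≤x*) (s , x≤s , s≤x*) →
          r ∧ s , ∧-greatest x≤r x≤s , ≤-trans (x∧y≤x r s) r≤x*
      ; isLattice = record
        { isPartialOrder = record
          { isPreorder = record
            { isEquivalence = record
              { refl  = Eq.refl
              ; sym   = Eq.sym
              ; trans = Eq.trans
              }
            ; reflexive     = reflexive
            ; trans         = ≤-trans
            }
          ; antisym    = antisym
          }
        ; supremum       = λ (r , _) (s , _) →
            x≤x∨y r s , y≤x∨y r s , λ _ → ∨-least
        ; infimum        = λ (r , _) (s , _) →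
            x∧y≤x r s , x∧y≤y r s , λ _ → ∧-greatest
        }
      }
    ; _*           = λ (s , x≤s , s≤x*) →
        s * , ≤-trans (reflexive (Eq.sym (*-involutive x))) (*-reverses-≤ s≤x*)
            , *-reverses-≤ x≤s
    ; *-reverses-≤ = *-reverses-≤
    ; *-involutive = λ (s , _) → *-involutive s
    }
    where
    ≤-trans = Lattice.trans lattice

record SubmodularOrderFunction (W : UniverseOfSeparations c ℓ₁ ℓ₂) : Set (c ⊔ ℓ₁) where
  open UniverseOfSeparations W
  field
    func : Func setoid ℝ-setoid

  open Func func public using (cong) renaming (to to ⟦_⟧)

  field
    nonNegative : ∀ s → 0ℝ ≤ℝ ⟦ s ⟧
    submodular  : ∀ r s → ⟦ r ∨ s ⟧ +ℝ ⟦ r ∧ s ⟧ ≤ℝ ⟦ r ⟧ +ℝ ⟦ s ⟧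
    symmetric   : ∀ s → ⟦ s ⟧ ≃ℝ ⟦ s * ⟧

open SubmodularOrderFunction public using (⟦_⟧)

IsMaximumValue : {A : Set c} → (A → ℝ) → ℝ → Set c
IsMaximumValue f k = (∃ λ z → f z ≃ℝ k) × (∀ z → f z ≤ℝ k)

{-# OPTIONS --safe #-}
-- Fix a rational K > k.  The function H which is 0 on the z ≥ x and
-- 1 + 2ⁿ − 2^(n − #{y ≤ z}) on the other z is strictly increasing on the latter
-- and submodular on incomparable pairs.  Put W z = H z + H (z *); this vanishes
-- exactly on U'.  Extending f by 0 outside U', the function g = f + K W works:
-- for incomparable r, s not both in U', at most one of r ∨ s, r ∧ s lies in U',
-- and if one does, then the inequality for W is strict, so that the gain K
-- pays for the value of f there.
module Submission where

open import Defs
open import Algebra.Bundles using (CommutativeMonoid)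
import Data.Fin.Properties as Fin
open import Data.Fin.Subset as Subset using (Subset; _∈_)
open import Data.Fin.Subset.Properties using (p⊆q⇒∣p∣≤∣q∣; p⊂q⇒∣p∣<∣q∣; ∣p∣≤n)
open import Data.Nat.Base as ℕ using (ℕ; zero; suc; z≤n; s≤s)
import Data.Nat.Properties as ℕ
open import Data.Product.Base using (Σ-syntax; ∃; _×_; _,_; proj₁; proj₂)
open import Data.Rational.Base as ℚ using (ℚ; 0ℚ; 1ℚ; ½; ∣_∣; _+_; _-_; _*_)
import Data.Rational.Properties as ℚ
open import Data.Rational.Solver using (module +-*-Solver)
open import Data.Sum.Base using (inj₁; inj₂)
open import Data.Vec.Base using (tabulate)
open import Data.Vec.Properties using (lookup∘tabulate; lookup⇒[]=; []=⇒lookup)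
open import Function.Base using (_∘_)
open import Function.Bundles using (Inverse)
import Function.Construct.Symmetry as Symmetry
open import Function.Properties.Bijection using (Bijection⇒Inverse)
open import Function.Properties.Inverse using (Inverse⇒Injection)
open import Relation.Binary.Bundles using (Setoid; Preorder)
open import Relation.Binary.Definitions using (Decidable)
import Relation.Binary.Lattice.Properties.JoinSemilattice as JoinSemilattice
open import Relation.Binary.PropositionalEquality
  using (_≡_; refl; sym; trans; cong; cong₂; subst; subst₂; module ≡-Reasoning)
open import Relation.Nullary.Decidable
  using (Dec; yes; no; does; dec-true; via-injection; _×-dec_)
open import Relation.Nullary.Negation.Core using (¬_; contradiction)

open import Algebra.Properties.CommutativeSemigroup ℕ.+-commutativeSemigroup
  using (interchange)
open import Algebra.Properties.CommutativeSemigroup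
  (CommutativeMonoid.commutativeSemigroup ℚ.+-0-commutativeMonoid)
  using () renaming (interchange to +-interchange)
open import Algebra.Properties.Monoid.Mult ℚ.+-0-monoid
  using (×-homo-+) renaming (_×_ to _·_)

open ℝ

private
  module ℝ≃ = Setoid ℝ-setoid

-- Order and addition of real numbers

p≤∣p∣ : ∀ p → p ℚ.≤ ∣ p ∣
p≤∣p∣ p with ℚ.≤-total 0ℚ p
... | inj₁ 0≤p = ℚ.≤-reflexive (sym (ℚ.0≤p⇒∣p∣≡p 0≤p))
... | inj₂ p≤0 = ℚ.≤-trans p≤0 (ℚ.0≤∣p∣ p)

p≤q+∣p-q∣ : ∀ p q → p ℚ.≤ q + ∣ p - q ∣
p≤q+∣p-q∣ p q = subst (ℚ._≤ q + ∣ p - q ∣) (cancel p q) (ℚ.+-monoʳ-≤ q (p≤∣p∣ (p - q)))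
  where
  open +-*-Solver
  cancel : ∀ p q → q + (p - q) ≡ p
  cancel = solve 2 (λ p q → q :+ (p :- q) := p) refl

p≤p+q : ∀ p {q} → 0ℚ ℚ.≤ q → p ℚ.≤ p + q
p≤p+q p {q} 0≤q = subst (ℚ._≤ p + q) (ℚ.+-identityʳ p) (ℚ.+-monoʳ-≤ p 0≤q)

0<½*p : ∀ {p} → 0ℚ ℚ.< p → 0ℚ ℚ.< p * ½
0<½*p {p} 0<p = subst (ℚ._< p * ½) (ℚ.*-zeroˡ ½) (ℚ.*-monoˡ-<-pos ½ 0<p)

½p+½p≡p : ∀ p → p * ½ + p * ½ ≡ p
½p+½p≡p p = trans (sym (ℚ.*-distribˡ-+ p ½ ½)) (ℚ.*-identityʳ p)

fromℚ : ℚ → ℝ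
fromℚ q = mkℝ (λ _ → q) λ ε 0<ε → 0 , λ _ _ _ _ →
  subst (ℚ._< ε) (sym (cong ∣_∣ (ℚ.+-inverseʳ q))) 0<ε

pointwise⇒≤ℝ : ∀ {a b} → (∀ n → seq a n ℚ.≤ seq b n) → a ≤ℝ b
pointwise⇒≤ℝ a≤b ε 0<ε = 0 , λ n _ → ℚ.≤-trans (a≤b n) (p≤p+q _ (ℚ.<⇒≤ 0<ε))

≤ℝ-reflexive : ∀ {a b} → a ≃ℝ b → a ≤ℝ b
≤ℝ-reflexive {a} {b} a≃b ε 0<ε =
  let N , p = a≃b ε 0<ε
  in N , λ n N≤n → ℚ.≤-trans (p≤q+∣p-q∣ (seq a n) (seq b n))
                     (ℚ.+-monoʳ-≤ (seq b n) (ℚ.<⇒≤ (p n N≤n)))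

≤ℝ-trans : ∀ {a b d} → a ≤ℝ b → b ≤ℝ d → a ≤ℝ d
≤ℝ-trans {a} {b} {d} a≤b b≤d ε 0<ε =
  let N , p = a≤b (ε * ½) (0<½*p 0<ε)
      M , q = b≤d (ε * ½) (0<½*p 0<ε)
  in N ℕ.⊔ M , λ n N⊔M≤n → begin
    seq a n                       ≤⟨ p n (ℕ.m⊔n≤o⇒m≤o N M N⊔M≤n) ⟩
    seq b n + ε * ½               ≤⟨ ℚ.+-monoˡ-≤ (ε * ½) (q n (ℕ.m⊔n≤o⇒n≤o N M N⊔M≤n)) ⟩
    seq d n + ε * ½ + ε * ½       ≡⟨ ℚ.+-assoc (seq d n) (ε * ½) (ε * ½) ⟩
    seq d n + (ε * ½ + ε * ½)     ≡⟨ cong (seq d n +_) (½p+½p≡p ε) ⟩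
    seq d n + ε                   ∎
  where open ℚ.≤-Reasoning

≤ℝ-preorder : Preorder _ _ _
≤ℝ-preorder = record
  { _≈_        = _≃ℝ_
  ; _≲_        = _≤ℝ_
  ; isPreorder = record
    { isEquivalence = ℝ≃.isEquivalence
    ; reflexive     = λ {a} {b} → ≤ℝ-reflexive {a} {b}
    ; trans         = λ {a} {b} {d} → ≤ℝ-trans {a} {b} {d}
    }
  }

≤ℝ-refl : ∀ {a} → a ≤ℝ a
≤ℝ-refl {a} = pointwise⇒≤ℝ {a} {a} λ _ → ℚ.≤-refl

+ℝ-mono-≤ℝ : ∀ {a b d e} → a ≤ℝ b → d ≤ℝ e → (a +ℝ d) ≤ℝ (b +ℝ e)
+ℝ-mono-≤ℝ {a} {b} {d} {e} a≤b d≤e ε 0<ε =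
  let N , p = a≤b (ε * ½) (0<½*p 0<ε)
      M , q = d≤e (ε * ½) (0<½*p 0<ε)
  in N ℕ.⊔ M , λ n N⊔M≤n → subst (seq a n + seq d n ℚ.≤_)
       (trans (+-interchange (seq b n) (ε * ½) (seq e n) (ε * ½))
              (cong (seq b n + seq e n +_) (½p+½p≡p ε)))
       (ℚ.+-mono-≤ (p n (ℕ.m⊔n≤o⇒m≤o N M N⊔M≤n)) (q n (ℕ.m⊔n≤o⇒n≤o N M N⊔M≤n)))

+ℝ-congʳ-fromℚ : ∀ {a b} q → a ≃ℝ b → (a +ℝ fromℚ q) ≃ℝ (b +ℝ fromℚ q)
+ℝ-congʳ-fromℚ {a} {b} q a≃b ε 0<ε =
  let N , p = a≃b ε 0<ε
  in N , λ n N≤n → subst (λ d → ∣ d ∣ ℚ.< ε) (cancel (seq a n) (seq b n) q) (p n N≤n)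
  where
  open +-*-Solver
  cancel : ∀ p r q → p - r ≡ (p + q) - (r + q)
  cancel = solve 3 (λ p r q → p :- r := (p :+ q) :- (r :+ q)) refl

+ℝ-identityʳ : ∀ a → (a +ℝ fromℚ 0ℚ) ≃ℝ a
+ℝ-identityʳ a ε 0<ε = 0 , λ n _ → subst (ℚ._< ε)
  (sym (cong ∣_∣ (trans (cong (_- seq a n) (ℚ.+-identityʳ (seq a n))) (ℚ.+-inverseʳ (seq a n))))) 0<ε

+ℝ-interchange-fromℚ : ∀ a b p q →
  ((a +ℝ fromℚ p) +ℝ (b +ℝ fromℚ q)) ≃ℝ ((a +ℝ b) +ℝ fromℚ (p + q))
+ℝ-interchange-fromℚ a b p q ε 0<ε = 0 , λ n _ → subst (λ d → ∣ d ∣ ℚ.< ε)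
  (sym (vanish (seq a n) (seq b n) p q)) 0<ε
  where
  open +-*-Solver
  vanish : ∀ a b p q → ((a + p) + (b + q)) - ((a + b) + (p + q)) ≡ 0ℚ
  vanish = solve 4 (λ a b p q → ((a :+ p) :+ (b :+ q)) :- ((a :+ b) :+ (p :+ q)) := con 0ℚ) refl

-- From index N on the sequence stays within 1 of its N-th term; the second unit of the bound
-- supplies the gap that `<ℝ` demands. Positivity is recorded because q will scale the penalty.
bounded-above : ∀ a → ∃ λ q → 0ℚ ℚ.< q × a <ℝ fromℚ q
bounded-above a =
  let N , close = cauchy a 1ℚ 0<1
      M = ∣ seq a N ∣
  in M + (1ℚ + 1ℚ)
   , ℚ.≤-<-trans (ℚ.0≤∣p∣ (seq a N))
       (subst (ℚ._< M + (1ℚ + 1ℚ)) (ℚ.+-identityʳ M) (ℚ.+-monoʳ-< M 0<2))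
   , 1ℚ , 0<1 , N , λ n N≤n → begin
       seq a n + 1ℚ                              ≤⟨ ℚ.+-monoˡ-≤ 1ℚ (p≤q+∣p-q∣ (seq a n) (seq a N)) ⟩
       seq a N + ∣ seq a n - seq a N ∣ + 1ℚ      ≤⟨ ℚ.+-monoˡ-≤ 1ℚ (ℚ.+-mono-≤ (p≤∣p∣ (seq a N))
                                                      (ℚ.<⇒≤ (close n N N≤n ℕ.≤-refl))) ⟩
       M + 1ℚ + 1ℚ                               ≡⟨ ℚ.+-assoc M 1ℚ 1ℚ ⟩
       M + (1ℚ + 1ℚ)                             ∎
  where
  open ℚ.≤-Reasoning
  0<1 : 0ℚ ℚ.< 1ℚ
  0<1 = ℚ.positive⁻¹ 1ℚ
  0<2 : 0ℚ ℚ.< 1ℚ + 1ℚ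
  0<2 = ℚ.positive⁻¹ (1ℚ + 1ℚ)

<ℝ⇒≤ℝ : ∀ {a b} → a <ℝ b → a ≤ℝ b
<ℝ⇒≤ℝ {a} (δ , 0<δ , N , p) ε 0<ε = N , λ n N≤n →
  ℚ.≤-trans (p≤p+q (seq a n) (ℚ.<⇒≤ 0<δ)) (ℚ.≤-trans (p n N≤n) (p≤p+q _ (ℚ.<⇒≤ 0<ε)))

0≤m·q : ∀ m {q} → 0ℚ ℚ.≤ q → 0ℚ ℚ.≤ m · q
0≤m·q zero    0≤q = ℚ.≤-refl
0≤m·q (suc m) 0≤q = ℚ.+-mono-≤ 0≤q (0≤m·q m 0≤q)

·-monoˡ-≤ : ∀ {m n q} → 0ℚ ℚ.≤ q → m ℕ.≤ n → m · q ℚ.≤ n · q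
·-monoˡ-≤ {n = n}     0≤q z≤n       = 0≤m·q n 0≤q
·-monoˡ-≤ {q = q}     0≤q (s≤s m≤n) = ℚ.+-monoʳ-≤ q (·-monoˡ-≤ 0≤q m≤n)

-- A weight 2ᴺ ∸ 2^(N ∸ h) that turns strict monotonicity of h into submodularity

-- The bound `a + b ≤ n` keeps every truncated difference exact. It is applied with n = 2ᴺ and
-- powers of 2 for a and b.
a+b≤n⇒n+[n∸[a+b]]≡[n∸a]+[n∸b] : ∀ {n} a b → a ℕ.+ b ℕ.≤ n →
  n ℕ.+ (n ℕ.∸ (a ℕ.+ b)) ≡ (n ℕ.∸ a) ℕ.+ (n ℕ.∸ b)
a+b≤n⇒n+[n∸[a+b]]≡[n∸a]+[n∸b] {n} a b a+b≤n = begin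
  n ℕ.+ (n ℕ.∸ (a ℕ.+ b))                 ≡⟨ ℕ.+-comm n _ ⟩
  n ℕ.∸ (a ℕ.+ b) ℕ.+ n                   ≡⟨ cong (ℕ._+ n) (sym (ℕ.∸-+-assoc n a b)) ⟩
  n ℕ.∸ a ℕ.∸ b ℕ.+ n                     ≡⟨ cong (n ℕ.∸ a ℕ.∸ b ℕ.+_) (sym (ℕ.m+[n∸m]≡n b≤n)) ⟩
  n ℕ.∸ a ℕ.∸ b ℕ.+ (b ℕ.+ (n ℕ.∸ b))     ≡⟨ sym (ℕ.+-assoc (n ℕ.∸ a ℕ.∸ b) b (n ℕ.∸ b)) ⟩
  n ℕ.∸ a ℕ.∸ b ℕ.+ b ℕ.+ (n ℕ.∸ b)       ≡⟨ cong (ℕ._+ (n ℕ.∸ b)) (ℕ.m∸n+n≡m b≤n∸a) ⟩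
  (n ℕ.∸ a) ℕ.+ (n ℕ.∸ b)                 ∎
  where
  open ≡-Reasoning
  b≤n : b ℕ.≤ n
  b≤n = ℕ.≤-trans (ℕ.m≤n+m b a) a+b≤n
  b≤n∸a : b ℕ.≤ n ℕ.∸ a
  b≤n∸a = subst (ℕ._≤ n ℕ.∸ a) (ℕ.m+n∸m≡n a b) (ℕ.∸-monoˡ-≤ a a+b≤n)

module Weight (N : ℕ) where

  weight : ℕ → ℕ
  weight h = 2 ℕ.^ N ℕ.∸ 2 ℕ.^ (N ℕ.∸ h)

  -- The bound by N matters: past N the truncated exponent stays 0 and the weight is constant.
  weight-strict : ∀ {h h′} → h ℕ.< h′ → h′ ℕ.≤ N → weight h ℕ.< weight h′
  weight-strict {h} h<h′ h′≤N = ℕ.∸-monoʳ-<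
    (ℕ.^-monoʳ-< 2 ℕ.≤-refl (ℕ.∸-monoʳ-< h<h′ h′≤N))
    (ℕ.^-monoʳ-≤ 2 (ℕ.m∸n≤m N h))

  private
    halves : ∀ {h h′} → h ℕ.< h′ → h′ ℕ.≤ N → 2 ℕ.* 2 ℕ.^ (N ℕ.∸ h′) ℕ.≤ 2 ℕ.^ (N ℕ.∸ h)
    -- `2 * 2 ^ m` is `2 ^ suc m` by definition, and the strict inequality of exponents absorbs this
    -- `suc`.
    halves h<h′ h′≤N = ℕ.^-monoʳ-≤ 2 (ℕ.∸-monoʳ-< h<h′ h′≤N)

  -- Any step up from `hᵐ` covers at least half of the distance from `weight hᵐ` to 2ᴺ. The steps to
  -- `h₁` and `h₂` together cover all of it, and `weight hʲ` never exceeds 2ᴺ.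
  weight-submodular : ∀ {hᵐ h₁ h₂} hʲ → hᵐ ℕ.< h₁ → hᵐ ℕ.< h₂ → h₁ ℕ.≤ N → h₂ ℕ.≤ N →
    weight hʲ ℕ.+ weight hᵐ ℕ.≤ weight h₁ ℕ.+ weight h₂
  weight-submodular {hᵐ} {h₁} {h₂} hʲ hᵐ<h₁ hᵐ<h₂ h₁≤N h₂≤N = begin
    weight hʲ ℕ.+ weight hᵐ             ≤⟨ ℕ.+-mono-≤ (ℕ.m∸n≤m _ (2 ℕ.^ (N ℕ.∸ hʲ)))
                                             (ℕ.∸-monoʳ-≤ (2 ℕ.^ N) a+b≤e) ⟩
    2 ℕ.^ N ℕ.+ (2 ℕ.^ N ℕ.∸ (a ℕ.+ b)) ≡⟨ a+b≤n⇒n+[n∸[a+b]]≡[n∸a]+[n∸b] a b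
                                             (ℕ.≤-trans a+b≤e (ℕ.^-monoʳ-≤ 2 (ℕ.m∸n≤m N hᵐ))) ⟩
    weight h₁ ℕ.+ weight h₂             ∎
    where
    open ℕ.≤-Reasoning
    a = 2 ℕ.^ (N ℕ.∸ h₁)
    b = 2 ℕ.^ (N ℕ.∸ h₂)
    e = 2 ℕ.^ (N ℕ.∸ hᵐ)
    a+b≤e : a ℕ.+ b ℕ.≤ e
    -- After doubling, each summand on the left can be bounded by e separately.
    a+b≤e = ℕ.*-cancelˡ-≤ 2 (begin
      2 ℕ.* (a ℕ.+ b)       ≡⟨ ℕ.*-distribˡ-+ 2 a b ⟩
      2 ℕ.* a ℕ.+ 2 ℕ.* b   ≤⟨ ℕ.+-mono-≤ (halves hᵐ<h₁ h₁≤N) (halves hᵐ<h₂ h₂≤N) ⟩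
      e ℕ.+ e               ≡⟨ cong (e ℕ.+_) (sym (ℕ.+-identityʳ e)) ⟩
      2 ℕ.* e               ∎)

-- Counting the elements below a given one

module Height {c ℓ₁ ℓ₂} (U : UniverseOfSeparations c ℓ₁ ℓ₂) (finite : Finite U) where
  open UniverseOfSeparations U renaming (trans to ≤-trans; refl to ≤-refl)

  size : ℕ
  size = proj₁ finite

  private
    enum : Inverse _ setoid
    enum = Bijection⇒Inverse (proj₂ finite)
    open Inverse enum using (to; from; strictlyInverseˡ)

  abstract
    -- Equality is decided on the indices of a finite carrier, and the order reduces to equality
    -- through the join.
    _≤?_ : Decidable _≤_
    _≤?_ = JoinSemilattice.≈-dec⇒≤-dec joinSemilattice
      (via-injection (Inverse⇒Injection (Symmetry.inverse enum)) Fin._≟_)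

  -- Elements are represented by their indices, so that cardinalities of `Subset` are available; the
  -- enumeration being bijective, each class of `_≈_` counts once.
  down : Carrier → Subset size
  down z = tabulate λ i → does (to i ≤? z)

  ∈-down⁺ : ∀ {i z} → to i ≤ z → i ∈ down z
  ∈-down⁺ {i} {z} i≤z = lookup⇒[]= i (down z) (trans (lookup∘tabulate _ i) (dec-true (to i ≤? z) i≤z))

  ∈-down⁻ : ∀ {i z} → i ∈ down z → to i ≤ z
  ∈-down⁻ {i} {z} i∈ with to i ≤? z | trans (sym (lookup∘tabulate (λ i → does (to i ≤? z)) i)) ([]=⇒lookup i∈)
  ... | yes i≤z | _ = i≤z
  ... | no  _   | ()

  height : Carrier → ℕ
  height z = Subset.∣ down z ∣

  height-mono : ∀ {r s} → r ≤ s → height r ℕ.≤ height s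
  height-mono r≤s = p⊆q⇒∣p∣≤∣q∣ λ i∈ → ∈-down⁺ (≤-trans (∈-down⁻ i∈) r≤s)

  -- The index of s itself separates the two sets: it belongs to `down s`, and belonging to `down r`
  -- would mean `s ≤ r`.
  height-strict : ∀ {r s} → r ≤ s → ¬ s ≤ r → height r ℕ.< height s
  height-strict {r} {s} r≤s s≰r = p⊂q⇒∣p∣<∣q∣
    ( (λ i∈ → ∈-down⁺ (≤-trans (∈-down⁻ i∈) r≤s))
    , from s
    , ∈-down⁺ (reflexive (strictlyInverseˡ s))
    , λ s∈ → s≰r (≤-trans (reflexive (Eq.sym (strictlyInverseˡ s))) (∈-down⁻ s∈))
    )

  height≤size : ∀ z → height z ℕ.≤ size
  height≤size z = ∣p∣≤n (down z)

-- The involution, De Morgan laws and the symmetric interval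

module DeMorgan {c ℓ₁ ℓ₂} (U : UniverseOfSeparations c ℓ₁ ℓ₂) where
  open UniverseOfSeparations U renaming (trans to ≤-trans; refl to ≤-refl)

  *-≤-swapˡ : ∀ {r s} → r * ≤ s → s * ≤ r
  *-≤-swapˡ {r} r*≤s = ≤-trans (*-reverses-≤ r*≤s) (reflexive (*-involutive r))

  *-≤-swapʳ : ∀ {r s} → r ≤ s * → s ≤ r *
  *-≤-swapʳ {s = s} r≤s* = ≤-trans (reflexive (Eq.sym (*-involutive s))) (*-reverses-≤ r≤s*)

  *-cancel-≤ : ∀ {r s} → r * ≤ s * → s ≤ r
  *-cancel-≤ {r} r*≤s* = ≤-trans (*-≤-swapʳ r*≤s*) (reflexive (*-involutive r))

  *-cong : ∀ {r s} → r ≈ s → r * ≈ s *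
  *-cong r≈s = antisym (*-reverses-≤ (reflexive (Eq.sym r≈s))) (*-reverses-≤ (reflexive r≈s))

  -- For the harder direction, a lower bound of `r *` and `s *` is carried across the involution,
  -- where it becomes an upper bound of r and s.
  ∨-* : ∀ r s → (r ∨ s) * ≈ r * ∧ s *
  ∨-* r s = antisym
    (∧-greatest (*-reverses-≤ (x≤x∨y r s)) (*-reverses-≤ (y≤x∨y r s)))
    (*-≤-swapʳ (∨-least (*-≤-swapʳ (x∧y≤x (r *) (s *))) (*-≤-swapʳ (x∧y≤y (r *) (s *)))))

  ∧-* : ∀ r s → (r ∧ s) * ≈ r * ∨ s *
  ∧-* r s = antisym
    (*-≤-swapˡ (∧-greatest (*-≤-swapˡ (x≤x∨y (r *) (s *))) (*-≤-swapˡ (y≤x∨y (r *) (s *)))))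
    (∨-least (*-reverses-≤ (x∧y≤x r s)) (*-reverses-≤ (x∧y≤y r s)))

  Incomparable : Carrier → Carrier → Set ℓ₂
  Incomparable r s = ¬ r ≤ s × ¬ s ≤ r

  *-incomparable : ∀ {r s} → Incomparable r s → Incomparable (r *) (s *)
  *-incomparable (r≰s , s≰r) = (λ p → s≰r (*-cancel-≤ p)) , (λ p → r≰s (*-cancel-≤ p))

  ∈-interval-* : ∀ {x z} → InInterval U x z → InInterval U x (z *)
  ∈-interval-* (x≤z , z≤x*) = *-≤-swapʳ z≤x* , *-reverses-≤ x≤z

  ∈-interval-resp : ∀ {x r s} → r ≈ s → InInterval U x r → InInterval U x s
  ∈-interval-resp r≈s (x≤r , r≤x*) =
    ≤-trans x≤r (reflexive r≈s) , ≤-trans (reflexive (Eq.sym r≈s)) r≤x*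

-- A symmetric penalty vanishing exactly on the interval

module Penalty {c ℓ₁ ℓ₂} (U : UniverseOfSeparations c ℓ₁ ℓ₂) (finite : Finite U)
               (x : UniverseOfSeparations.Carrier U) where
  open UniverseOfSeparations U renaming (trans to ≤-trans; refl to ≤-refl)
  open Height U finite
  open Weight size
  open DeMorgan U

  abstract
    -- The `suc` makes positivity off the up-set of x immediate. The drop to 0 on that up-set
    -- produces strictness once a join reaches it.
    H : Carrier → ℕ
    H z with x ≤? z
    ... | yes _ = 0
    ... | no  _ = suc (weight (height z))

    H-above : ∀ {z} → x ≤ z → H z ≡ 0
    H-above {z} x≤z with x ≤? z
    ... | yes _   = refl
    ... | no  x≰z = contradiction x≤z x≰z

    H-notAbove : ∀ {z} → ¬ x ≤ z → H z ≡ suc (weight (height z))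
    H-notAbove {z} x≰z with x ≤? z
    ... | yes x≤z = contradiction x≤z x≰z
    ... | no  _   = refl

  H-cong : ∀ {r s} → r ≈ s → H r ≡ H s
  H-cong {r} {s} r≈s with x ≤? r
  ... | yes x≤r = trans (H-above x≤r) (sym (H-above (≤-trans x≤r (reflexive r≈s))))
  ... | no  x≰r = begin
    H r                          ≡⟨ H-notAbove x≰r ⟩
    suc (weight (height r))      ≡⟨ cong (suc ∘ weight) (ℕ.≤-antisym (height-mono (reflexive r≈s))
                                      (height-mono (reflexive (Eq.sym r≈s)))) ⟩
    suc (weight (height s))      ≡⟨ H-notAbove (λ x≤s → x≰r (≤-trans x≤s (reflexive (Eq.sym r≈s)))) ⟨
    H s                          ∎
    where open ≡-Reasoning

  -- As the elements above x form an up-set, r is not above x either, so both values come from the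
  -- weight.
  H-strict : ∀ {r s} → r ≤ s → ¬ s ≤ r → ¬ x ≤ s → H r ℕ.< H s
  H-strict {r} {s} r≤s s≰r x≰s = subst₂ ℕ._<_
    (sym (H-notAbove λ x≤r → x≰s (≤-trans x≤r r≤s))) (sym (H-notAbove x≰s))
    (s≤s (weight-strict (height-strict r≤s s≰r) (height≤size s)))

  r≰r∧s : ∀ {r s} → Incomparable r s → ¬ r ≤ r ∧ s
  r≰r∧s {r} {s} (r≰s , _) r≤r∧s = r≰s (≤-trans r≤r∧s (x∧y≤y r s))

  s≰r∧s : ∀ {r s} → Incomparable r s → ¬ s ≤ r ∧ s
  s≰r∧s {r} {s} (_ , s≰r) s≤r∧s = s≰r (≤-trans s≤r∧s (x∧y≤x r s))

  -- The join contributes 0. One of r and s is not above x, and the meet lies strictly below it, so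
  -- `H-strict` already gives the inequality with that one term on the right.
  H-strictlySubmodular : ∀ {r s} → Incomparable r s → x ≤ r ∨ s → ¬ (x ≤ r × x ≤ s) →
    suc (H (r ∨ s) ℕ.+ H (r ∧ s)) ℕ.≤ H r ℕ.+ H s
  H-strictlySubmodular {r} {s} inc x≤r∨s ¬both
    rewrite H-above x≤r∨s with x ≤? r
  ... | yes x≤r = ℕ.≤-trans (H-strict (x∧y≤y r s) (s≰r∧s inc) (λ x≤s → ¬both (x≤r , x≤s)))
                    (ℕ.m≤n+m (H s) (H r))
  ... | no  x≰r = ℕ.≤-trans (H-strict (x∧y≤x r s) (r≰r∧s inc) x≰r) (ℕ.m≤m+n (H r) (H s))

  -- If r and s are both above x, so are join and meet, and the left side is 0. If the join is above
  -- x but not both of r and s are, the strict version applies. If the join is not above x, none of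
  -- the four elements is, and the weights decide.
  H-submodular : ∀ {r s} → Incomparable r s → H (r ∨ s) ℕ.+ H (r ∧ s) ℕ.≤ H r ℕ.+ H s
  H-submodular {r} {s} inc with x ≤? (r ∨ s) | (x ≤? r) ×-dec (x ≤? s)
  ... | _           | yes (x≤r , x≤s)
    rewrite H-above (≤-trans x≤r (x≤x∨y r s)) | H-above (∧-greatest x≤r x≤s) = z≤n
  ... | yes x≤r∨s   | no ¬both = ℕ.<⇒≤ (H-strictlySubmodular inc x≤r∨s ¬both)
  -- Each side carries two units from `H`; `+-suc` brings the inner ones to the front so that they
  -- cancel.
  ... | no  x≰r∨s   | no _
    rewrite H-notAbove x≰r∨s
          | H-notAbove (λ x≤r → x≰r∨s (≤-trans x≤r (x≤x∨y r s)))
          | H-notAbove (λ x≤s → x≰r∨s (≤-trans x≤s (y≤x∨y r s)))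
          | H-notAbove (λ x≤r∧s → x≰r∨s (≤-trans x≤r∧s (≤-trans (x∧y≤x r s) (x≤x∨y r s))))
          | ℕ.+-suc (weight (height (r ∨ s))) (weight (height (r ∧ s)))
          | ℕ.+-suc (weight (height r)) (weight (height s))
    = s≤s (s≤s (weight-submodular (height (r ∨ s))
        (height-strict (x∧y≤x r s) (r≰r∧s inc)) (height-strict (x∧y≤y r s) (s≰r∧s inc))
        (height≤size r) (height≤size s)))

  W : Carrier → ℕ
  W z = H z ℕ.+ H (z *)

  W-cong : ∀ {r s} → r ≈ s → W r ≡ W s
  W-cong r≈s = cong₂ ℕ._+_ (H-cong r≈s) (H-cong (*-cong r≈s))

  W-* : ∀ z → W z ≡ W (z *)
  W-* z = trans (ℕ.+-comm (H z) (H (z *))) (cong (H (z *) ℕ.+_) (H-cong (Eq.sym (*-involutive z))))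

  -- The bound `z ≤ x *` turns into `x ≤ z *`, so the two summands of `W` test the two ends of the
  -- interval.
  W-inside : ∀ {z} → InInterval U x z → W z ≡ 0
  W-inside (x≤z , z≤x*) = cong₂ ℕ._+_ (H-above x≤z) (H-above (*-≤-swapʳ z≤x*))

  W-outside : ∀ {z} → ¬ InInterval U x z → 1 ℕ.≤ W z
  W-outside {z} z∉ with x ≤? z
  ... | no  x≰z rewrite H-notAbove x≰z = s≤s z≤n
  ... | yes x≤z rewrite H-above x≤z | H-notAbove (λ x≤z* → z∉ (x≤z , *-≤-swapʳ x≤z*)) = s≤s z≤n

  private
    -- The involution exchanges join and meet and preserves incomparability, so this is
    -- `H-submodular` at `r *` and `s *`.
    H-submodular-* : ∀ {r s} → Incomparable r s →
      H ((r ∨ s) *) ℕ.+ H ((r ∧ s) *) ℕ.≤ H (r *) ℕ.+ H (s *)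
    H-submodular-* {r} {s} inc
      rewrite H-cong (∨-* r s) | H-cong (∧-* r s) | ℕ.+-comm (H (r * ∧ s *)) (H (r * ∨ s *))
      = H-submodular (*-incomparable inc)

  W-submodular : ∀ {r s} → Incomparable r s → W (r ∨ s) ℕ.+ W (r ∧ s) ℕ.≤ W r ℕ.+ W s
  W-submodular {r} {s} inc = subst₂ ℕ._≤_
    (interchange (H (r ∨ s)) (H (r ∧ s)) _ _) (interchange (H r) (H s) _ _)
    (ℕ.+-mono-≤ (H-submodular inc) (H-submodular-* inc))

  -- The first summand of `W` alone yields strictness: if r and s were both above x, then, their
  -- join being below `x *`, both would lie in the interval.
  W-strictlySubmodular : ∀ {r s} → Incomparable r s → InInterval U x (r ∨ s) →
    ¬ (InInterval U x r × InInterval U x s) →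
    suc (W (r ∨ s) ℕ.+ W (r ∧ s)) ℕ.≤ W r ℕ.+ W s
  W-strictlySubmodular {r} {s} inc (x≤r∨s , r∨s≤x*) ¬both = subst₂ ℕ._≤_
    (cong suc (interchange (H (r ∨ s)) (H (r ∧ s)) _ _)) (interchange (H r) (H s) _ _)
    (ℕ.+-mono-≤ (H-strictlySubmodular inc x≤r∨s λ (x≤r , x≤s) → ¬both
        ( (x≤r , ≤-trans (x≤x∨y r s) r∨s≤x*)
        , (x≤s , ≤-trans (y≤x∨y r s) r∨s≤x*)))
      (H-submodular-* inc))

-- Extension of f by zero plus a multiple of the penalty

module Extension {c ℓ₁ ℓ₂} (U : UniverseOfSeparations c ℓ₁ ℓ₂) (finite : Finite U)
                 (x : UniverseOfSeparations.Carrier U)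
                 (f : SubmodularOrderFunction (interval U x))
                 (K : ℚ) (0<K : 0ℚ ℚ.< K)
                 (f≤K : ∀ z → ⟦ f ⟧ z ≤ℝ fromℚ K) where
  open UniverseOfSeparations U renaming (trans to ≤-trans; refl to ≤-refl)
  open Height U finite using (_≤?_)
  open DeMorgan U
  open Penalty U finite x
  module f = SubmodularOrderFunction f
  open import Relation.Binary.Reasoning.Preorder ≤ℝ-preorder

  private
    0≤K : 0ℚ ℚ.≤ K
    0≤K = ℚ.<⇒≤ 0<K

  inInterval? : ∀ z → Dec (InInterval U x z)
  inInterval? z = (x ≤? z) ×-dec (z ≤? (x *))

  abstract
    f⁰ : Carrier → ℝ
    f⁰ z with inInterval? z
    ... | yes z∈ = ⟦ f ⟧ (z , z∈)
    ... | no  _  = 0ℝ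

    -- The decision procedure may return a membership proof other than `z∈`. Equality in the
    -- interval ignores these proofs, so `f.cong` identifies the two values.
    f⁰-inside : ∀ {z} (z∈ : InInterval U x z) → f⁰ z ≃ℝ ⟦ f ⟧ (z , z∈)
    f⁰-inside {z} z∈ with inInterval? z
    ... | yes _   = f.cong Eq.refl
    ... | no  z∉  = contradiction z∈ z∉

    f⁰-outside : ∀ {z} → ¬ InInterval U x z → f⁰ z ≡ 0ℝ
    f⁰-outside {z} z∉ with inInterval? z
    ... | yes z∈ = contradiction z∈ z∉
    ... | no  _  = refl

    f⁰-cong : ∀ {r s} → r ≈ s → f⁰ r ≃ℝ f⁰ s
    f⁰-cong {r} {s} r≈s with inInterval? r
    ... | yes r∈ = ℝ≃.trans {⟦ f ⟧ (r , r∈)} {⟦ f ⟧ (s , s∈)} {f⁰ s}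
                     (f.cong r≈s) (ℝ≃.sym {f⁰ s} {⟦ f ⟧ (s , s∈)} (f⁰-inside s∈))
      where
      s∈ : InInterval U x s
      s∈ = ∈-interval-resp r≈s r∈
    ... | no  r∉ = ℝ≃.reflexive (sym (f⁰-outside λ s∈ → r∉ (∈-interval-resp (Eq.sym r≈s) s∈)))

    f⁰-* : ∀ z → f⁰ z ≃ℝ f⁰ (z *)
    f⁰-* z with inInterval? z
    ... | yes z∈ = ℝ≃.trans {⟦ f ⟧ (z , z∈)} {⟦ f ⟧ (z * , z*∈)} {f⁰ (z *)}
                     (ℝ≃.trans {⟦ f ⟧ (z , z∈)} {⟦ f ⟧ (z * , _)} {⟦ f ⟧ (z * , z*∈)}
                       (f.symmetric (z , z∈)) (f.cong Eq.refl))
                     (ℝ≃.sym {f⁰ (z *)} {⟦ f ⟧ (z * , z*∈)} (f⁰-inside z*∈))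
      where
      z*∈ : InInterval U x (z *)
      z*∈ = ∈-interval-* z∈
    -- Applying the involution once more would carry membership of `z *` back to z.
    ... | no  z∉ = ℝ≃.reflexive (sym (f⁰-outside λ z*∈ →
                     z∉ (∈-interval-resp (*-involutive z) (∈-interval-* z*∈))))

    f⁰-nonNegative : ∀ z → 0ℝ ≤ℝ f⁰ z
    f⁰-nonNegative z with inInterval? z
    ... | yes z∈ = f.nonNegative (z , z∈)
    ... | no  _  = ≤ℝ-refl {0ℝ}

    f⁰≤K : ∀ z → f⁰ z ≤ℝ fromℚ K
    f⁰≤K z with inInterval? z
    ... | yes z∈ = f≤K (z , z∈)
    ... | no  _  = pointwise⇒≤ℝ {0ℝ} {fromℚ K} λ _ → 0≤K

  g : Carrier → ℝ
  g z = f⁰ z +ℝ fromℚ (W z · K)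

  g-cong : ∀ {r s} → r ≈ s → g r ≃ℝ g s
  g-cong {r} {s} r≈s rewrite W-cong r≈s = +ℝ-congʳ-fromℚ {f⁰ r} {f⁰ s} (W s · K) (f⁰-cong r≈s)

  g-reflexive : ∀ {r s} → r ≈ s → g r ≤ℝ g s
  g-reflexive {r} {s} r≈s = ≤ℝ-reflexive {g r} {g s} (g-cong r≈s)

  g-symmetric : ∀ z → g z ≃ℝ g (z *)
  g-symmetric z rewrite sym (W-* z) = +ℝ-congʳ-fromℚ {f⁰ z} {f⁰ (z *)} (W z · K) (f⁰-* z)

  g-nonNegative : ∀ z → 0ℝ ≤ℝ g z
  g-nonNegative z = begin
    0ℝ                       ≲⟨ pointwise⇒≤ℝ {0ℝ} {0ℝ +ℝ 0ℝ} (λ _ → ℚ.≤-refl) ⟩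
    0ℝ +ℝ 0ℝ                 ≲⟨ +ℝ-mono-≤ℝ {0ℝ} {f⁰ z} {0ℝ} {fromℚ (W z · K)} (f⁰-nonNegative z)
                                  (pointwise⇒≤ℝ {0ℝ} {fromℚ (W z · K)} λ _ → 0≤m·q (W z) 0≤K) ⟩
    g z                      ∎

  SubmodularAt : Carrier → Carrier → Set
  SubmodularAt r s = (g (r ∨ s) +ℝ g (r ∧ s)) ≤ℝ (g r +ℝ g s)

  private
    g+g : ∀ r s → (g r +ℝ g s) ≃ℝ ((f⁰ r +ℝ f⁰ s) +ℝ fromℚ ((W r ℕ.+ W s) · K))
    g+g r s rewrite ×-homo-+ K (W r) (W s) = +ℝ-interchange-fromℚ (f⁰ r) (f⁰ s) (W r · K) (W s · K)

    0≤f⁰+f⁰ : ∀ r s → 0ℝ ≤ℝ (f⁰ r +ℝ f⁰ s)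
    0≤f⁰+f⁰ r s = begin
      0ℝ             ≲⟨ pointwise⇒≤ℝ {0ℝ} {0ℝ +ℝ 0ℝ} (λ _ → ℚ.≤-refl) ⟩
      0ℝ +ℝ 0ℝ       ≲⟨ +ℝ-mono-≤ℝ {0ℝ} {f⁰ r} {0ℝ} {f⁰ s} (f⁰-nonNegative r) (f⁰-nonNegative s) ⟩
      f⁰ r +ℝ f⁰ s   ∎

  -- An excess of j K on the side of f⁰ is balanced by an excess of j on the side of W.
  submodularAt : ∀ j r s →
    (f⁰ (r ∨ s) +ℝ f⁰ (r ∧ s)) ≤ℝ ((f⁰ r +ℝ f⁰ s) +ℝ fromℚ (j · K)) →
    j ℕ.+ (W (r ∨ s) ℕ.+ W (r ∧ s)) ℕ.≤ W r ℕ.+ W s →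
    SubmodularAt r s
  submodularAt j r s f⁰≤ W≤ = begin
    g (r ∨ s) +ℝ g (r ∧ s)                                ≈⟨ g+g (r ∨ s) (r ∧ s) ⟩
    (f⁰ (r ∨ s) +ℝ f⁰ (r ∧ s)) +ℝ fromℚ (m · K)            ≲⟨ +ℝ-mono-≤ℝ
        {f⁰ (r ∨ s) +ℝ f⁰ (r ∧ s)} {(f⁰ r +ℝ f⁰ s) +ℝ fromℚ (j · K)} {fromℚ (m · K)} {fromℚ (m · K)}
        f⁰≤ (≤ℝ-refl {fromℚ (m · K)}) ⟩
    ((f⁰ r +ℝ f⁰ s) +ℝ fromℚ (j · K)) +ℝ fromℚ (m · K)      ≲⟨ pointwise⇒≤ℝ
        {((f⁰ r +ℝ f⁰ s) +ℝ fromℚ (j · K)) +ℝ fromℚ (m · K)} {(f⁰ r +ℝ f⁰ s) +ℝ fromℚ ((W r ℕ.+ W s) · K)}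
        collect ⟩
    (f⁰ r +ℝ f⁰ s) +ℝ fromℚ ((W r ℕ.+ W s) · K)            ≈⟨ g+g r s ⟨
    g r +ℝ g s                                            ∎
    where
    m = W (r ∨ s) ℕ.+ W (r ∧ s)
    collect : ∀ n → seq (f⁰ r +ℝ f⁰ s) n + j · K + m · K ℚ.≤ seq (f⁰ r +ℝ f⁰ s) n + (W r ℕ.+ W s) · K
    collect n = subst (ℚ._≤ seq (f⁰ r +ℝ f⁰ s) n + (W r ℕ.+ W s) · K)
      (sym (trans (ℚ.+-assoc (seq (f⁰ r +ℝ f⁰ s) n) (j · K) (m · K))
                  (cong (seq (f⁰ r +ℝ f⁰ s) n +_) (sym (×-homo-+ K j m)))))
      (ℚ.+-monoʳ-≤ (seq (f⁰ r +ℝ f⁰ s) n) (·-monoˡ-≤ 0≤K W≤))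

  -- Join and meet of comparable elements are these elements again, so both sides agree. This covers
  -- the pairs about which the penalty lemmas say nothing.
  submodularAt-≤ : ∀ {r s} → r ≤ s → SubmodularAt r s
  submodularAt-≤ {r} {s} r≤s = begin
    g (r ∨ s) +ℝ g (r ∧ s)   ≲⟨ +ℝ-mono-≤ℝ {g (r ∨ s)} {g s} {g (r ∧ s)} {g r}
        (g-reflexive (antisym (∨-least r≤s ≤-refl) (y≤x∨y r s)))
        (g-reflexive (antisym (x∧y≤x r s) (∧-greatest ≤-refl r≤s))) ⟩
    g s +ℝ g r               ≲⟨ pointwise⇒≤ℝ {g s +ℝ g r} {g r +ℝ g s}
        (λ n → ℚ.≤-reflexive (ℚ.+-comm (seq (g s) n) (seq (g r) n))) ⟩
    g r +ℝ g s               ∎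

  submodularAt-≥ : ∀ {r s} → s ≤ r → SubmodularAt r s
  submodularAt-≥ {r} {s} s≤r = +ℝ-mono-≤ℝ {g (r ∨ s)} {g r} {g (r ∧ s)} {g s}
    (g-reflexive (antisym (∨-least ≤-refl s≤r) (x≤x∨y r s)))
    (g-reflexive (antisym (x∧y≤y r s) (∧-greatest s≤r ≤-refl)))

  -- Both r and s lie between their meet and their join. Read contrapositively, this excludes one of
  -- the two corners from the interval when r or s is outside.
  interval-convex : ∀ {r s} → InInterval U x (r ∨ s) → InInterval U x (r ∧ s) →
    InInterval U x r × InInterval U x s
  interval-convex {r} {s} (_ , r∨s≤x*) (x≤r∧s , _) =
      (≤-trans x≤r∧s (x∧y≤x r s) , ≤-trans (x≤x∨y r s) r∨s≤x*)
    , (≤-trans x≤r∧s (x∧y≤y r s) , ≤-trans (y≤x∨y r s) r∨s≤x*)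

  submodularAt-inside : ∀ {r s} → Incomparable r s → InInterval U x r → InInterval U x s →
    SubmodularAt r s
  submodularAt-inside {r} {s} inc r∈ s∈ = submodularAt 0 r s f⁰≤ (W-submodular inc)
    where
    open UniverseOfSeparations (interval U x) using () renaming (_∨_ to _∨′_; _∧_ to _∧′_)
    r′ = r , r∈
    s′ = s , s∈
    f⁰≤ : (f⁰ (r ∨ s) +ℝ f⁰ (r ∧ s)) ≤ℝ ((f⁰ r +ℝ f⁰ s) +ℝ fromℚ 0ℚ)
    f⁰≤ = begin
      f⁰ (r ∨ s) +ℝ f⁰ (r ∧ s)                 ≲⟨ +ℝ-mono-≤ℝ {f⁰ (r ∨ s)} {⟦ f ⟧ (r′ ∨′ s′)} {f⁰ (r ∧ s)} {⟦ f ⟧ (r′ ∧′ s′)}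
          (≤ℝ-reflexive {f⁰ (r ∨ s)} {⟦ f ⟧ (r′ ∨′ s′)} (f⁰-inside _))
          (≤ℝ-reflexive {f⁰ (r ∧ s)} {⟦ f ⟧ (r′ ∧′ s′)} (f⁰-inside _)) ⟩
      ⟦ f ⟧ (r′ ∨′ s′) +ℝ ⟦ f ⟧ (r′ ∧′ s′)     ≲⟨ f.submodular r′ s′ ⟩
      ⟦ f ⟧ r′ +ℝ ⟦ f ⟧ s′                     ≲⟨ +ℝ-mono-≤ℝ {⟦ f ⟧ r′} {f⁰ r} {⟦ f ⟧ s′} {f⁰ s}
          (≤ℝ-reflexive {⟦ f ⟧ r′} {f⁰ r} (ℝ≃.sym {f⁰ r} {⟦ f ⟧ r′} (f⁰-inside r∈)))
          (≤ℝ-reflexive {⟦ f ⟧ s′} {f⁰ s} (ℝ≃.sym {f⁰ s} {⟦ f ⟧ s′} (f⁰-inside s∈))) ⟩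
      f⁰ r +ℝ f⁰ s                             ≈⟨ +ℝ-identityʳ (f⁰ r +ℝ f⁰ s) ⟨
      (f⁰ r +ℝ f⁰ s) +ℝ fromℚ 0ℚ               ∎

  submodularAt-∨-inside : ∀ {r s} → Incomparable r s → InInterval U x (r ∨ s) → SubmodularAt r s
  submodularAt-∨-inside {r} {s} inc ∨∈ with inInterval? r ×-dec inInterval? s
  ... | yes (r∈ , s∈) = submodularAt-inside inc r∈ s∈
  -- Here j = 1: the value at the join is at most K, which is one unit of penalty.
  ... | no  ¬both     = submodularAt 1 r s f⁰≤ (W-strictlySubmodular inc ∨∈ ¬both)
    where
    f⁰≤ : (f⁰ (r ∨ s) +ℝ f⁰ (r ∧ s)) ≤ℝ ((f⁰ r +ℝ f⁰ s) +ℝ fromℚ (1 · K))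
    -- By convexity the meet is outside, so only the join contributes to the left side.
    f⁰≤ rewrite f⁰-outside {r ∧ s} (λ ∧∈ → ¬both (interval-convex ∨∈ ∧∈)) = begin
      f⁰ (r ∨ s) +ℝ 0ℝ                    ≲⟨ +ℝ-mono-≤ℝ {f⁰ (r ∨ s)} {fromℚ K} {0ℝ} {f⁰ r +ℝ f⁰ s}
                                               (f⁰≤K (r ∨ s)) (0≤f⁰+f⁰ r s) ⟩
      fromℚ K +ℝ (f⁰ r +ℝ f⁰ s)           ≲⟨ pointwise⇒≤ℝ {fromℚ K +ℝ (f⁰ r +ℝ f⁰ s)} {(f⁰ r +ℝ f⁰ s) +ℝ fromℚ (1 · K)}
                                               (λ n → ℚ.≤-reflexive (trans (ℚ.+-comm K _)
                                                 (cong (seq (f⁰ r +ℝ f⁰ s) n +_) (sym (ℚ.+-identityʳ K))))) ⟩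
      (f⁰ r +ℝ f⁰ s) +ℝ fromℚ (1 · K)     ∎

  -- Dual to the previous case: the involution maps the meet to the join of `r *` and `s *`, again
  -- in the interval, and `g` is symmetric.
  submodularAt-∧-inside : ∀ {r s} → Incomparable r s → InInterval U x (r ∧ s) → SubmodularAt r s
  submodularAt-∧-inside {r} {s} inc ∧∈ = begin
    g (r ∨ s) +ℝ g (r ∧ s)               ≲⟨ pointwise⇒≤ℝ {g (r ∨ s) +ℝ g (r ∧ s)} {g (r ∧ s) +ℝ g (r ∨ s)}
        (λ n → ℚ.≤-reflexive (ℚ.+-comm (seq (g (r ∨ s)) n) (seq (g (r ∧ s)) n))) ⟩
    g (r ∧ s) +ℝ g (r ∨ s)               ≲⟨ +ℝ-mono-≤ℝ {g (r ∧ s)} {g (r * ∨ s *)} {g (r ∨ s)} {g (r * ∧ s *)}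
        (g≤g* (r ∧ s) (∧-* r s)) (g≤g* (r ∨ s) (∨-* r s)) ⟩
    g (r * ∨ s *) +ℝ g (r * ∧ s *)       ≲⟨ submodularAt-∨-inside (*-incomparable inc)
        (∈-interval-resp (∧-* r s) (∈-interval-* ∧∈)) ⟩
    g (r *) +ℝ g (s *)                   ≲⟨ +ℝ-mono-≤ℝ {g (r *)} {g r} {g (s *)} {g s} (g*≤g r) (g*≤g s) ⟩
    g r +ℝ g s                           ∎
    where
    g≤g* : ∀ z {w} → z * ≈ w → g z ≤ℝ g w
    g≤g* z {w} z*≈w = begin
      g z     ≈⟨ g-symmetric z ⟩
      g (z *) ≈⟨ g-cong z*≈w ⟩
      g w     ∎
    g*≤g : ∀ z → g (z *) ≤ℝ g z
    g*≤g z = ≤ℝ-reflexive {g (z *)} {g z} (ℝ≃.sym {g z} {g (z *)} (g-symmetric z))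

  -- `f⁰` vanishes at both corners and is nonnegative at r and s, so the non-strict inequality for
  -- `W` suffices.
  submodularAt-outside : ∀ {r s} → Incomparable r s →
    ¬ InInterval U x (r ∨ s) → ¬ InInterval U x (r ∧ s) → SubmodularAt r s
  submodularAt-outside {r} {s} inc ∨∉ ∧∉ = submodularAt 0 r s f⁰≤ (W-submodular inc)
    where
    f⁰≤ : (f⁰ (r ∨ s) +ℝ f⁰ (r ∧ s)) ≤ℝ ((f⁰ r +ℝ f⁰ s) +ℝ fromℚ 0ℚ)
    f⁰≤ rewrite f⁰-outside ∨∉ | f⁰-outside ∧∉ = begin
      0ℝ +ℝ 0ℝ                    ≲⟨ pointwise⇒≤ℝ {0ℝ +ℝ 0ℝ} {0ℝ} (λ _ → ℚ.≤-refl) ⟩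
      0ℝ                          ≲⟨ 0≤f⁰+f⁰ r s ⟩
      f⁰ r +ℝ f⁰ s                ≈⟨ +ℝ-identityʳ (f⁰ r +ℝ f⁰ s) ⟨
      (f⁰ r +ℝ f⁰ s) +ℝ fromℚ 0ℚ  ∎

  g-submodular : ∀ r s → SubmodularAt r s
  g-submodular r s with r ≤? s | s ≤? r | inInterval? (r ∨ s) | inInterval? (r ∧ s)
  ... | yes r≤s | _       | _      | _      = submodularAt-≤ r≤s
  ... | _       | yes s≤r | _      | _      = submodularAt-≥ s≤r
  ... | no  r≰s | no  s≰r | yes ∨∈ | _      = submodularAt-∨-inside (r≰s , s≰r) ∨∈
  ... | no  r≰s | no  s≰r | _      | yes ∧∈ = submodularAt-∧-inside (r≰s , s≰r) ∧∈
  ... | no  r≰s | no  s≰r | no ∨∉  | no ∧∉  = submodularAt-outside (r≰s , s≰r) ∨∉ ∧∉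

  extension : SubmodularOrderFunction U
  extension = record
    { func        = record { to = g ; cong = g-cong }
    ; nonNegative = g-nonNegative
    ; submodular  = g-submodular
    ; symmetric   = g-symmetric
    }

  extension-inside : ∀ z (z∈ : InInterval U x z) → g z ≃ℝ ⟦ f ⟧ (z , z∈)
  extension-inside z z∈ rewrite W-inside z∈ =
    ℝ≃.trans {f⁰ z +ℝ fromℚ 0ℚ} {f⁰ z} {⟦ f ⟧ (z , z∈)} (+ℝ-identityʳ (f⁰ z)) (f⁰-inside z∈)

  -- At least one full K is paid outside the interval, so the gap ε between k and K is also a gap
  -- between k and `g z`.
  extension-outside : ∀ {k} → k <ℝ fromℚ K → ∀ z → ¬ InInterval U x z → k <ℝ g z
  extension-outside {k} (ε , 0<ε , N , p) z z∉ rewrite f⁰-outside z∉ =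
    ε , 0<ε , N , λ n N≤n → ℚR.begin
      seq k n + ε           ℚR.≤⟨ p n N≤n ⟩
      K                     ℚR.≡⟨ sym (ℚ.+-identityʳ K) ⟩
      1 · K                 ℚR.≤⟨ ·-monoˡ-≤ 0≤K (W-outside z∉) ⟩
      W z · K               ℚR.≡⟨ sym (ℚ.+-identityˡ (W z · K)) ⟩
      0ℚ + W z · K          ℚR.∎
    where module ℚR = ℚ.≤-Reasoning

theorem5p5 : ∀ {c ℓ₁ ℓ₂} (U : UniverseOfSeparations c ℓ₁ ℓ₂) → Finite U →
    (x : UniverseOfSeparations.Carrier U) →
    UniverseOfSeparations.Carrier (interval U x) →
    (f : SubmodularOrderFunction (interval U x)) (k : ℝ) →
    IsMaximumValue ⟦ f ⟧ k →
    Σ[ g ∈ SubmodularOrderFunction U ]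
    ((∀ z (z∈U' : InInterval U x z) → ⟦ g ⟧ z ≃ℝ ⟦ f ⟧ (z , z∈U')) ×
    (∀ z → ¬ (InInterval U x z) → k <ℝ ⟦ g ⟧ z))
theorem5p5 U finite x _ f k (_ , f≤k) = extension , extension-inside , extension-outside {k} k<K
  where
  bound = bounded-above k
  -- Scaling by k itself would give only k where the penalty is 1; a bound strictly above k leaves
  -- room for the strict inequality, and a rational one makes its multiples constant sequences.
  K     = proj₁ bound
  k<K   = proj₂ (proj₂ bound)
  f≤K : ∀ z → ⟦ f ⟧ z ≤ℝ fromℚ K
  f≤K z = ≤ℝ-trans {⟦ f ⟧ z} {k} {fromℚ K} (f≤k z) (<ℝ⇒≤ℝ {k} {fromℚ K} k<K)
  open Extension U finite x f K (proj₁ (proj₂ bound)) f≤K
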